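{- Let $m\in\mathbb{N}$ with $m\ge1$. (a) If $m$ is odd, then $F_m$ is $\mathbb{Z}_m$-cordial. Moreover, $F_n$ is $\mathbb{Z}_m$-cordial for all $n\in\mathbb{N}$ if and only if $F_1,F_2,\ldots,F_{m-1}$ are $\mathbb{Z}_m$-cordial. (b) If $m$ is even, then $F_{2m}$ is $\mathbb{Z}_m$-cordial. Moreover, $F_n$ is $\mathbb{Z}_m$-cordial for all $n\in\mathbb{N}$ if and only if $F_1,F_2,\ldots,F_{2m-1}$ are $\mathbb{Z}_m$-cordial. (c) If $m$ is even but $4\nmid m$, then $F_m$ is not $\mathbb{Z}_m$-cordial.
   Context: $\mathbb{N}=\mathbb{Z}_{\ge0}$. Graphs are finite, simple and undirected. For $n\in\mathbb{N}$, the friendship graph $F_n$ is the union of $n$ copies of the triangle $C_3$ joined at a single common (central) vertex. For an abelian group $A$ and a graph $G=(V,E)$, a vertex labeling $\ell:V\to A$ induces an edge labeling $\ell(\{v_1,v_2\})=\ell(v_1)+\ell(v_2)$. Let $f_V(a)=|\{v\in V:\ell(v)=a\}|$ and $f_E(a)=|\{e\in E:\ell(e)=a\}|$. The labeling is $A$-cordial if $|f_V(a_1)-f_V(a_2)|\le 1$ and $|f_E(a_1)-f_E(a_2)|\le 1$ for all $a_1,a_2\in A$; $G$ is $A$-cordial if it admits an $A$-cordial labeling. -}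

module Defs where

open import Algebra.Bundles using (AbelianGroup)
open import Data.Empty using (⊥)
open import Data.Fin as Fin using (Fin; zero; suc; toℕ; quotient)
import Data.Fin.Properties as Fin
open import Data.List using (List; allFin; cartesianProduct; filter; length)
open import Data.Nat using (ℕ; suc; _+_; _*_; _∸_; _≤_; ∣_-_∣; NonZero; >-nonZero⁻¹)
open import Data.Nat.DivMod
  using (_%_; _mod_; m%n<n; m<n⇒m%n≡m; m%n%n≡m%n; n%n≡0; %-distribˡ-+)
open import Data.Nat.Properties using (+-comm; +-assoc; m∸n+n≡m; <⇒≤)
open import Data.Product using (_×_; _,_; ∃)
open import Data.Unit using (⊤; tt)
open import Level using (0ℓ)
open import Relation.Binary using (Rel; Decidable; Symmetric)
open import Relation.Binary.PropositionalEquality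
open import Relation.Nullary using (¬_; yes; no)
open import Relation.Nullary.Decidable using (_×-dec_; ¬?)

record Graph : Set₁ where
  field
    order  : ℕ
    Adj    : Rel (Fin order) 0ℓ
    adj?   : Decidable Adj
    symm   : Symmetric Adj
    irrefl : ∀ {v} → ¬ Adj v v

  vertices : List (Fin order)
  vertices = allFin order

  -- Each undirected edge {u , v} is listed once, as the pair with u < v.
  edges : List (Fin order × Fin order)
  edges = filter (λ (u , v) → (u Fin.<? v) ×-dec adj? u v)
                 (cartesianProduct vertices vertices)

module _ {c ℓ} (A : AbelianGroup c ℓ)
         (_≟_ : Decidable (AbelianGroup._≈_ A)) (G : Graph) where
  open AbelianGroup A using (Carrier; _∙_)
  open Graph G

  Labeling : Set c
  Labeling = Fin order → Carrier

  f-V : Labeling → Carrier → ℕ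
  f-V lab a = length (filter (λ v → lab v ≟ a) vertices)

  f-E : Labeling → Carrier → ℕ
  f-E lab a = length (filter (λ (u , v) → (lab u ∙ lab v) ≟ a) edges)

  IsCordial : Labeling → Set c
  IsCordial lab = ∀ a₁ a₂ → ∣ f-V lab a₁ - f-V lab a₂ ∣ ≤ 1
                          × ∣ f-E lab a₁ - f-E lab a₂ ∣ ≤ 1

  Cordial : Set c
  Cordial = ∃ IsCordial

-- Vertex zero is the centre.  The outer vertices suc i, with i : Fin (n * 2),
-- are paired off as 2k and 2k + 1; the k-th pair and the centre form the
-- k-th triangle.
module _ {n : ℕ} where
  FAdj : Rel (Fin (suc (n * 2))) 0ℓ
  FAdj zero    zero    = ⊥
  FAdj zero    (suc _) = ⊤
  FAdj (suc _) zero    = ⊤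
  FAdj (suc i) (suc j) = quotient {n} 2 i ≡ quotient {n} 2 j × i ≢ j

  FAdj? : Decidable FAdj
  FAdj? zero    zero    = no λ ()
  FAdj? zero    (suc _) = yes tt
  FAdj? (suc _) zero    = yes tt
  FAdj? (suc i) (suc j) =
    (quotient {n} 2 i Fin.≟ quotient {n} 2 j) ×-dec ¬? (i Fin.≟ j)

  FAdj-sym : Symmetric FAdj
  FAdj-sym {zero}  {suc _} _       = tt
  FAdj-sym {suc _} {zero}  _       = tt
  FAdj-sym {suc _} {suc _} (p , q) = sym p , ≢-sym q

  FAdj-irrefl : ∀ {v} → ¬ FAdj v v
  FAdj-irrefl {suc _} (_ , i≢i) = i≢i refl

F : ℕ → Graph
F n = record
  { order  = suc (n * 2)
  ; Adj    = FAdj {n}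
  ; adj?   = FAdj? {n}
  ; symm   = λ {u} {v} → FAdj-sym {n} {u} {v}
  ; irrefl = λ {v} → FAdj-irrefl {n} {v}
  }

module _ (m : ℕ) .{{_ : NonZero m}} where

  _⊕_ : Fin m → Fin m → Fin m
  i ⊕ j = (toℕ i + toℕ j) mod m

  ⊖_ : Fin m → Fin m
  ⊖ i = (m ∸ toℕ i) mod m

  toℕ-mod : ∀ k → toℕ (k mod m) ≡ k % m
  toℕ-mod k = Fin.toℕ-fromℕ< (m%n<n k m)

  toℕ-% : ∀ (i : Fin m) → toℕ i % m ≡ toℕ i
  toℕ-% i = m<n⇒m%n≡m (Fin.toℕ<n i)

  %-+ˡ : ∀ a b → (a % m + b) % m ≡ (a + b) % m
  %-+ˡ a b = begin
    (a % m + b) % m          ≡⟨ %-distribˡ-+ (a % m) b m ⟩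
    (a % m % m + b % m) % m  ≡⟨ cong (λ x → (x + b % m) % m) (m%n%n≡m%n a m) ⟩
    (a % m + b % m) % m      ≡⟨ %-distribˡ-+ a b m ⟨
    (a + b) % m              ∎
    where open ≡-Reasoning

  ⊕-comm : ∀ i j → i ⊕ j ≡ j ⊕ i
  ⊕-comm i j = cong (_mod m) (+-comm (toℕ i) (toℕ j))

  ⊕-assoc : ∀ i j k → (i ⊕ j) ⊕ k ≡ i ⊕ (j ⊕ k)
  ⊕-assoc i j k = Fin.toℕ-injective (begin
    toℕ ((i ⊕ j) ⊕ k)        ≡⟨ toℕ-mod (toℕ (i ⊕ j) + z) ⟩
    (toℕ (i ⊕ j) + z) % m    ≡⟨ cong (λ a → (a + z) % m) (toℕ-mod (x + y)) ⟩
    ((x + y) % m + z) % m    ≡⟨ %-+ˡ (x + y) z ⟩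
    (x + y + z) % m          ≡⟨ cong (_% m) (trans (+-assoc x y z) (+-comm x (y + z))) ⟩
    (y + z + x) % m          ≡⟨ %-+ˡ (y + z) x ⟨
    ((y + z) % m + x) % m    ≡⟨ cong (_% m) (+-comm ((y + z) % m) x) ⟩
    (x + (y + z) % m) % m    ≡⟨ cong (λ a → (x + a) % m) (toℕ-mod (y + z)) ⟨
    (x + toℕ (j ⊕ k)) % m    ≡⟨ toℕ-mod (x + toℕ (j ⊕ k)) ⟨
    toℕ (i ⊕ (j ⊕ k))        ∎)
    where
    open ≡-Reasoning
    x = toℕ i
    y = toℕ j
    z = toℕ k

  ⊕-identityˡ : ∀ i → (0 mod m) ⊕ i ≡ i
  ⊕-identityˡ i = Fin.toℕ-injective (begin
    toℕ ((0 mod m) ⊕ i)            ≡⟨ toℕ-mod (toℕ (0 mod m) + toℕ i) ⟩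
    (toℕ (0 mod m) + toℕ i) % m    ≡⟨ cong (λ a → (a + toℕ i) % m) (toℕ-mod 0) ⟩
    (0 % m + toℕ i) % m            ≡⟨ %-+ˡ 0 (toℕ i) ⟩
    toℕ i % m                      ≡⟨ toℕ-% i ⟩
    toℕ i                          ∎)
    where open ≡-Reasoning

  ⊕-inverseˡ : ∀ i → (⊖ i) ⊕ i ≡ 0 mod m
  ⊕-inverseˡ i = Fin.toℕ-injective (begin
    toℕ ((⊖ i) ⊕ i)                ≡⟨ toℕ-mod (toℕ (⊖ i) + x) ⟩
    (toℕ (⊖ i) + x) % m            ≡⟨ cong (λ a → (a + x) % m) (toℕ-mod (m ∸ x)) ⟩
    ((m ∸ x) % m + x) % m          ≡⟨ %-+ˡ (m ∸ x) x ⟩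
    (m ∸ x + x) % m                ≡⟨ cong (_% m) (m∸n+n≡m (<⇒≤ (Fin.toℕ<n i))) ⟩
    m % m                          ≡⟨ n%n≡0 m ⟩
    0                              ≡⟨ m<n⇒m%n≡m (>-nonZero⁻¹ m) ⟨
    0 % m                          ≡⟨ toℕ-mod 0 ⟨
    toℕ (0 mod m)                  ∎)
    where
    open ≡-Reasoning
    x = toℕ i

  ℤ/ : AbelianGroup 0ℓ 0ℓ
  ℤ/ = record
    { Carrier = Fin m
    ; _≈_     = _≡_
    ; _∙_     = _⊕_
    ; ε       = 0 mod m
    ; _⁻¹     = ⊖_
    ; isAbelianGroup = record
      { isGroup = record
        { isMonoid = record
          { isSemigroup = record
            { isMagma = record
              { isEquivalence = isEquivalence
              ; ∙-cong        = cong₂ _⊕_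
              }
            ; assoc = ⊕-assoc
            }
          ; identity = ⊕-identityˡ , λ i → trans (⊕-comm i _) (⊕-identityˡ i)
          }
        ; inverse = ⊕-inverseˡ , λ i → trans (⊕-comm i _) (⊕-inverseˡ i)
        ; ⁻¹-cong = cong ⊖_
        }
      ; comm = ⊕-comm
      }
    }

{-# OPTIONS --safe #-}

-- Adding N triangles whose outer labels take every value equally often, and
-- whose outer edge labels do so too, changes all vertex counts by one constant
-- and all edge counts by another, whatever the label of the centre.  For odd m
-- the triangles (k , k), k ∈ ℤ/m, do this, since doubling is bijective; for any
-- m the triangles (k , k) and (k , k + 1) do, since the numbers 2k and 2k + 1
-- with k < m are the numbers below 2m.  So F n may be reduced to
-- F (n mod N), and F 0 is trivially cordial.
-- For (c): in a cordial labelling of F m all 3m edge labels occur exactly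
-- 3 times, so they sum to 3m(m - 1)/2, which is odd; but modulo 2 each triangle
-- contributes 2(c + x + y) to this sum.
module Submission where

open import Defs
open import Algebra.Bundles using (AbelianGroup)
import Algebra.Properties.AbelianGroup
open import Data.Bool using (true; false; if_then_else_)
open import Data.Fin as Fin
  using (Fin; zero; suc; toℕ; combine; remQuot; quotient; _↑ˡ_; _↑ʳ_)
import Data.Fin.Properties as Fin
open import Data.Fin.Properties using (_≟_)
open import Data.List as List
  using (List; []; _∷_; tabulate; cartesianProduct; filter; length)
import Data.List.Properties as List
open import Data.Nat as ℕ
  using (ℕ; zero; suc; _+_; _*_; _≤_; _<_; ∣_-_∣; z≤n; s≤s; NonZero)
open import Data.Nat.Divisibility using (_∣_)
import Data.Nat.Divisibility as ℕ
import Data.Nat.DivMod as ℕ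
open import Data.Nat.DivMod using (_%_; _mod_)
open import Data.Nat.ListAction using () renaming (sum to sumᴸ)
import Data.Nat.Properties as ℕ
open import Data.Nat.Tactic.RingSolver using (solve-∀)
open import Data.Product using (_×_; _,_; ∃; uncurry; proj₁; proj₂)
open import Data.Vec.Functional using (Vector; _++_)
open import Data.Vec.Functional.Properties using (lookup-++ˡ; lookup-++ʳ)
open import Function using (_∘_; id)
open import Function.Bundles using (_⇔_; mk⇔)
open import Relation.Binary using (tri<; tri≈; tri>)
open import Relation.Binary.PropositionalEquality
open import Relation.Nullary using (¬_; Dec; does; contradiction)
open import Relation.Nullary.Decidable using (_×-dec_; ¬?; does-⇔)
open import Relation.Unary using (Pred; Decidable)
open import Algebra.Properties.Semiring.Sum ℕ.+-*-semiring
  using (sum; sum-syntax; sum-cong-≗; sum-replicate-zero; ∑-distrib-+; *-distribˡ-sum)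

private
  variable
    A B : Set
    m n : ℕ

-- Indicators and the Kronecker delta

⟦_⟧ : {P : Set} → Dec P → ℕ
⟦ P? ⟧ = if does P? then 1 else 0

δ : Fin n → Fin n → ℕ
δ i j = ⟦ i ≟ j ⟧

δ≤1 : (i j : Fin n) → δ i j ≤ 1
δ≤1 i j with does (i ≟ j)
... | true  = ℕ.≤-refl
... | false = z≤n

δ-cong-⇔ : {i j : Fin m} {k l : Fin n} → (i ≡ j → k ≡ l) → (k ≡ l → i ≡ j) → δ i j ≡ δ k l
δ-cong-⇔ to from = cong (if_then 1 else 0) (does-⇔ (mk⇔ to from) (_ ≟ _) (_ ≟ _))

δ-sym : (i j : Fin n) → δ i j ≡ δ j i
δ-sym i j = δ-cong-⇔ {i = i} {j} {j} {i} sym sym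

-- Finite sums

∑-const : ∀ n c → ∑[ i < n ] c ≡ n * c
∑-const zero    c = refl
∑-const (suc n) c = cong (c +_) (∑-const n c)

∑-mono-≤ : (f g : Vector ℕ n) → (∀ i → f i ≤ g i) → sum f ≤ sum g
∑-mono-≤ {zero}  f g f≤g = z≤n
∑-mono-≤ {suc n} f g f≤g = ℕ.+-mono-≤ (f≤g zero) (∑-mono-≤ (f ∘ suc) (g ∘ suc) (f≤g ∘ suc))

∑-mono-< : (f g : Vector ℕ n) → (∀ i → f i ≤ g i) → ∀ i → f i < g i → sum f < sum g
∑-mono-< {suc n} f g f≤g zero    fi<gi =
  ℕ.+-mono-<-≤ fi<gi (∑-mono-≤ (f ∘ suc) (g ∘ suc) (f≤g ∘ suc))
∑-mono-< {suc n} f g f≤g (suc i) fi<gi =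
  ℕ.+-mono-≤-< (f≤g zero) (∑-mono-< (f ∘ suc) (g ∘ suc) (f≤g ∘ suc) i fi<gi)

∑-∣ : ∀ d (f : Vector ℕ n) → (∀ i → d ∣ f i) → d ∣ sum f
∑-∣ {zero}  d f d∣f = d ℕ.∣0
∑-∣ {suc n} d f d∣f = ℕ.∣m∣n⇒∣m+n (d∣f zero) (∑-∣ d (f ∘ suc) (d∣f ∘ suc))

∑-split : ∀ m {n} (f : Vector ℕ (m + n)) →
          sum f ≡ ∑[ i < m ] f (i ↑ˡ n) + ∑[ j < n ] f (m ↑ʳ j)
∑-split zero    f = refl
∑-split (suc m) f =
  trans (cong (f zero +_) (∑-split m (f ∘ suc))) (sym (ℕ.+-assoc (f zero) _ _))

-- `combine k j` is the index 2k + j, so each induction step peels off two terms. This serves both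
-- for the outer vertices and for the numbers below 2m.
∑-pairs : ∀ n (f : Vector ℕ (n * 2)) →
          sum f ≡ ∑[ k < n ] (f (combine k zero) + f (combine k (suc zero)))
∑-pairs zero    f = refl
∑-pairs (suc n) f =
  trans (cong (λ s → f zero + (f (suc zero) + s)) (∑-pairs n (λ i → f (suc (suc i)))))
        (sym (ℕ.+-assoc (f zero) (f (suc zero)) _))

∑-δ : (j : Fin n) (w : Vector ℕ n) → ∑[ i < n ] (δ i j * w i) ≡ w j
∑-δ {suc n} zero    w = begin
  w zero + 0 + ∑[ i < n ] 0  ≡⟨ cong₂ _+_ (ℕ.+-identityʳ (w zero)) (sum-replicate-zero n) ⟩
  w zero + 0                 ≡⟨ ℕ.+-identityʳ (w zero) ⟩
  w zero                     ∎
  where open ≡-Reasoning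
∑-δ {suc n} (suc j) w = ∑-δ j (w ∘ suc)

-- `f k ≡ a` holds exactly when `k ≡ g a`, which leaves a single nonzero term.
∑-δ-bijective : (f g : Fin n → Fin n) → (∀ k → f (g k) ≡ k) → (∀ k → g (f k) ≡ k) →
                ∀ a → ∑[ k < n ] δ (f k) a ≡ 1
∑-δ-bijective f g fg gf a = trans
  (sum-cong-≗ λ k → trans
    (δ-cong-⇔ (λ fk≡a → trans (sym (gf k)) (cong g fk≡a))
              (λ k≡ga → trans (cong f k≡ga) (fg a)))
    (sym (ℕ.*-identityʳ (δ k (g a)))))
  (∑-δ (g a) (λ _ → 1))

-- Gauss's sum n(n - 1)/2, arranged to avoid both division and truncated subtraction.
∑-toℕ : ∀ n → 2 * ∑[ i < n ] toℕ i + n ≡ n * n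
∑-toℕ zero    = refl
∑-toℕ (suc n) = begin
  2 * ∑[ i < n ] suc (toℕ i) + suc n       ≡⟨ cong (λ s → 2 * s + suc n) (∑-distrib-+ {n} (λ _ → 1) toℕ) ⟩
  2 * (∑[ i < n ] 1 + T) + suc n           ≡⟨ cong (λ s → 2 * (s + T) + suc n) (∑-const n 1) ⟩
  2 * (n * 1 + T) + suc n                  ≡⟨ rearrange n T ⟩
  2 * T + n + suc (n + n)                  ≡⟨ cong (_+ suc (n + n)) (∑-toℕ n) ⟩
  n * n + suc (n + n)                      ≡⟨ square n ⟩
  suc n * suc n                            ∎
  where
  open ≡-Reasoning
  T : ℕ
  T = ∑[ i < n ] toℕ i
  rearrange : ∀ n T → 2 * (n * 1 + T) + suc n ≡ 2 * T + n + suc (n + n)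
  rearrange = solve-∀
  square : ∀ n → n * n + suc (n + n) ≡ suc n * suc n
  square = solve-∀

-- Balanced families

Balanced : (A → ℕ) → Set
Balanced f = ∀ a b → ∣ f a - f b ∣ ≤ 1

balanced-cong : {f g : A → ℕ} → f ≗ g → Balanced f → Balanced g
balanced-cong f≗g bal a b = subst₂ (λ x y → ∣ x - y ∣ ≤ 1) (f≗g a) (f≗g b) (bal a b)

balanced-+const : (f : A → ℕ) {g : A → ℕ} {c : ℕ} → (∀ a → g a ≡ f a + c) → Balanced f → Balanced g
balanced-+const f {c = c} g≡f+c bal = balanced-cong (sym ∘ g≡f+c) λ a b →
  subst (_≤ 1) (sym (shift a b)) (bal a b)
  where
  shift : ∀ a b → ∣ f a + c - f b + c ∣ ≡ ∣ f a - f b ∣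
  shift a b = trans (cong₂ ∣_-_∣ (ℕ.+-comm (f a) c) (ℕ.+-comm (f b) c))
                    (ℕ.∣m+n-m+o∣≡∣n-o∣ c (f a) (f b))

balanced-≤1 : (f : A → ℕ) → (∀ a → f a ≤ 1) → Balanced f
balanced-≤1 f f≤1 a b = ℕ.≤-trans (ℕ.∣m-n∣≤m⊔n (f a) (f b)) (ℕ.⊔-lub (f≤1 a) (f≤1 b))

balanced⇒≤1+ : (f : A → ℕ) → Balanced f → ∀ a b → f a ≤ suc (f b)
balanced⇒≤1+ f bal a b = begin
  f a                      ≤⟨ ℕ.m≤n+∣m-n∣ (f a) (f b) ⟩
  f b + ∣ f a - f b ∣      ≤⟨ ℕ.+-monoʳ-≤ (f b) (bal a b) ⟩
  f b + 1                  ≡⟨ ℕ.+-comm (f b) 1 ⟩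
  suc (f b)                ∎
  where open ℕ.≤-Reasoning

-- If some value is below the mean `t`, balance keeps all others at most `t`, and the sum falls
-- short of n t. A value above `t` is excluded symmetrically.
balanced⇒constant : (f : Vector ℕ n) {t : ℕ} → Balanced f → sum f ≡ n * t → ∀ a → f a ≡ t
balanced⇒constant {n} f {t} bal total a with ℕ.<-cmp (f a) t
... | tri≈ _ fa≡t _ = fa≡t
... | tri< fa<t _ _ = contradiction
  (∑-mono-< f (λ _ → t) (λ b → ℕ.≤-trans (balanced⇒≤1+ f bal b a) fa<t) a fa<t)
  (ℕ.<-irrefl (trans total (sym (∑-const n t))))
... | tri> _ _ t<fa = contradiction
  (∑-mono-< (λ _ → t) f (λ b → ℕ.s≤s⁻¹ (ℕ.≤-trans t<fa (balanced⇒≤1+ f bal a b))) a t<fa)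
  (ℕ.<-irrefl (trans (∑-const n t) (sym total)))

-- Sums over lists

∑ᴸ : (A → ℕ) → List A → ℕ
∑ᴸ f xs = sumᴸ (List.map f xs)

length-filter≡∑ᴸ : {P : Pred A _} (P? : Decidable P) (xs : List A) →
                   length (filter P? xs) ≡ ∑ᴸ (λ x → ⟦ P? x ⟧) xs
length-filter≡∑ᴸ P? []       = refl
length-filter≡∑ᴸ P? (x ∷ xs) with does (P? x)
... | true  = cong suc (length-filter≡∑ᴸ P? xs)
... | false = length-filter≡∑ᴸ P? xs

∑ᴸ-filter : {P : Pred A _} (P? : Decidable P) (f : A → ℕ) (xs : List A) →
            ∑ᴸ f (filter P? xs) ≡ ∑ᴸ (λ x → ⟦ P? x ⟧ * f x) xs
∑ᴸ-filter P? f []       = refl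
∑ᴸ-filter P? f (x ∷ xs) with does (P? x)
... | true  = cong₂ _+_ (sym (ℕ.+-identityʳ (f x))) (∑ᴸ-filter P? f xs)
... | false = ∑ᴸ-filter P? f xs

∑ᴸ-++ : (f : A → ℕ) (xs ys : List A) → ∑ᴸ f (xs List.++ ys) ≡ ∑ᴸ f xs + ∑ᴸ f ys
∑ᴸ-++ f []       ys = refl
∑ᴸ-++ f (x ∷ xs) ys = trans (cong (f x +_) (∑ᴸ-++ f xs ys)) (sym (ℕ.+-assoc (f x) _ _))

∑ᴸ-cartesianProduct : (f : A × B → ℕ) (xs : List A) (ys : List B) →
  ∑ᴸ f (cartesianProduct xs ys) ≡ ∑ᴸ (λ x → ∑ᴸ (λ y → f (x , y)) ys) xs
∑ᴸ-cartesianProduct f []       ys = refl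
∑ᴸ-cartesianProduct f (x ∷ xs) ys = trans
  (∑ᴸ-++ f (List.map (x ,_) ys) _)
  (cong₂ _+_ (cong sumᴸ (sym (List.map-∘ ys))) (∑ᴸ-cartesianProduct f xs ys))

∑ᴸ-tabulate : (f : A → ℕ) (g : Fin n → A) → ∑ᴸ f (tabulate g) ≡ ∑[ i < n ] f (g i)
∑ᴸ-tabulate {n = zero}  f g = refl
∑ᴸ-tabulate {n = suc n} f g = cong (f (g zero) +_) (∑ᴸ-tabulate f (g ∘ suc))

-- Double counting: each entry `x` lies in exactly one fibre, that of `g x`, and contributes
-- `w (g x)` there.
∑-fibres : (g : A → Fin m) (w : Vector ℕ m) (xs : List A) →
           ∑[ a < m ] (w a * length (filter (λ x → g x ≟ a) xs)) ≡ ∑ᴸ (w ∘ g) xs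
∑-fibres {m = m} g w []       =
  trans (sum-cong-≗ (λ a → ℕ.*-zeroʳ (w a))) (sum-replicate-zero m)
∑-fibres {m = m} g w (x ∷ xs) = begin
  ∑[ a < m ] (w a * fibre (x ∷ xs) a)
    ≡⟨ sum-cong-≗ step ⟩
  ∑[ a < m ] (δ a (g x) * w a + w a * fibre xs a)
    ≡⟨ ∑-distrib-+ {m} (λ a → δ a (g x) * w a) (λ a → w a * fibre xs a) ⟩
  ∑[ a < m ] (δ a (g x) * w a) + ∑[ a < m ] (w a * fibre xs a)
    ≡⟨ cong₂ _+_ (∑-δ (g x) w) (∑-fibres g w xs) ⟩
  w (g x) + ∑ᴸ (w ∘ g) xs ∎
  where
  open ≡-Reasoning
  fibre : List _ → Fin m → ℕ
  fibre ys a = length (filter (λ y → g y ≟ a) ys)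
  step : ∀ a → w a * fibre (x ∷ xs) a ≡ δ a (g x) * w a + w a * fibre xs a
  -- After the flip the delta uses the same test as `filter`, so one case split settles both sides.
  step a rewrite δ-sym a (g x) with does (g x ≟ a)
  ... | true  = trans (ℕ.*-suc (w a) (fibre xs a))
                      (cong (_+ w a * fibre xs a) (sym (ℕ.+-identityʳ (w a))))
  ... | false = refl

-- Sums over the edges of F n

left right : Fin n → Fin (suc (n * 2))
left  k = suc (combine k zero)
right k = suc (combine k (suc zero))

-- The indicator evaluates on constructors: among the first two outer vertices
-- only the pair (0 , 1) survives, and they share no edge with later ones.
∑-outer-edges : ∀ n (f : Fin (n * 2) → Fin (n * 2) → ℕ) →
  ∑[ i < n * 2 ] ∑[ j < n * 2 ]
    (⟦ (i Fin.<? j) ×-dec ((quotient {n} 2 i ≟ quotient {n} 2 j) ×-dec ¬? (i ≟ j)) ⟧ * f i j)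
  ≡ ∑[ k < n ] f (combine k zero) (combine k (suc zero))
∑-outer-edges zero    f = refl
∑-outer-edges (suc n) f = cong₂ _+_
  (trans (cong (f zero (suc zero) + 0 +_) (sum-replicate-zero (n * 2)))
         (trans (ℕ.+-identityʳ _) (ℕ.+-identityʳ _)))
  (cong₂ _+_ (sum-replicate-zero (n * 2))
             (∑-outer-edges n (λ i j → f (suc (suc i)) (suc (suc j)))))

∑-edges : ∀ n (f : Fin (suc (n * 2)) × Fin (suc (n * 2)) → ℕ) →
  ∑ᴸ f (Graph.edges (F n)) ≡
  ∑[ k < n ] (f (zero , left k) + f (zero , right k) + f (left k , right k))
∑-edges n f = begin
  ∑ᴸ f (Graph.edges (F n))
    ≡⟨ ∑ᴸ-filter edge? f (cartesianProduct vs vs) ⟩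
  ∑ᴸ g (cartesianProduct vs vs)
    ≡⟨ ∑ᴸ-cartesianProduct g vs vs ⟩
  ∑ᴸ (λ u → ∑ᴸ (λ v → g (u , v)) vs) vs
    ≡⟨ ∑ᴸ-tabulate (λ u → ∑ᴸ (λ v → g (u , v)) vs) id ⟩
  ∑[ u < suc (n * 2) ] ∑ᴸ (λ v → g (u , v)) vs
    ≡⟨ sum-cong-≗ (λ u → ∑ᴸ-tabulate (λ v → g (u , v)) id) ⟩
  ∑[ u < suc (n * 2) ] ∑[ v < suc (n * 2) ] g (u , v)
    -- The row of the centre gives the spokes: its indicator is 0 at the centre and 1 at every outer
    -- vertex. In the other rows the column of the centre vanishes because u < v fails there.
    ≡⟨ cong₂ _+_
         (trans (sum-cong-≗ {n * 2} (λ j → ℕ.+-identityʳ (f (zero , suc j))))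
                (∑-pairs n (λ j → f (zero , suc j))))
         (∑-outer-edges n (λ i j → f (suc i , suc j))) ⟩
  ∑[ k < n ] (f (zero , left k) + f (zero , right k)) + ∑[ k < n ] f (left k , right k)
    ≡⟨ ∑-distrib-+ {n} (λ k → f (zero , left k) + f (zero , right k)) (λ k → f (left k , right k)) ⟨
  ∑[ k < n ] (f (zero , left k) + f (zero , right k) + f (left k , right k)) ∎
  where
  open ≡-Reasoning
  vs = Graph.vertices (F n)
  edge? : Decidable (λ ((u , v) : Fin (suc (n * 2)) × Fin (suc (n * 2))) →
                       u Fin.< v × FAdj {n} u v)
  edge? (u , v) = (u Fin.<? v) ×-dec FAdj? {n} u v
  g : Fin (suc (n * 2)) × Fin (suc (n * 2)) → ℕ
  g e = ⟦ edge? e ⟧ * f e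

-- Label counts in terms of triangles

module _ (m : ℕ) .{{_ : NonZero m}} where

  private
    _⊞_ : Fin m → Fin m → Fin m
    _⊞_ = _⊕_ m
    ⊟_ : Fin m → Fin m
    ⊟_ = ⊖_ m
    module ℤₘ = AbelianGroup (ℤ/ m)
    open Algebra.Properties.AbelianGroup (ℤ/ m)
      using (\\-leftDividesˡ; \\-leftDividesʳ)

  -- Outer labels are kept as two families indexed by triangles, so that adding triangles is
  -- concatenation of families.
  outerV outerE : (x y : Fin n → Fin m) → Fin m → ℕ
  outerV {n} x y a = ∑[ k < n ] (δ (x k) a + δ (y k) a)
  outerE {n} x y a = ∑[ k < n ] δ (x k ⊞ y k) a

  δ-⊞ : ∀ c z a → δ (c ⊞ z) a ≡ δ z ((⊟ c) ⊞ a)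
  δ-⊞ c z a = δ-cong-⇔
    (λ cz≡a → trans (sym (\\-leftDividesʳ c z)) (cong ((⊟ c) ⊞_) cz≡a))
    (λ z≡ → trans (cong (c ⊞_) z≡) (\\-leftDividesˡ c a))

  f-V-F : ∀ n (lab : Fin (suc (n * 2)) → Fin m) a →
    f-V (ℤ/ m) _≟_ (F n) lab a ≡ δ (lab zero) a + outerV (lab ∘ left {n}) (lab ∘ right) a
  f-V-F n lab a = begin
    f-V (ℤ/ m) _≟_ (F n) lab a
      ≡⟨ length-filter≡∑ᴸ (λ v → lab v ≟ a) _ ⟩
    ∑ᴸ (λ v → δ (lab v) a) (Graph.vertices (F n))
      ≡⟨ ∑ᴸ-tabulate (λ v → δ (lab v) a) id ⟩
    δ (lab zero) a + ∑[ i < n * 2 ] δ (lab (suc i)) a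
      ≡⟨ cong (δ (lab zero) a +_) (∑-pairs n (λ i → δ (lab (suc i)) a)) ⟩
    δ (lab zero) a + outerV (lab ∘ left {n}) (lab ∘ right) a ∎
    where open ≡-Reasoning

  f-E-F : ∀ n (lab : Fin (suc (n * 2)) → Fin m) a →
    f-E (ℤ/ m) _≟_ (F n) lab a ≡
    outerV (lab ∘ left {n}) (lab ∘ right) ((⊟ lab zero) ⊞ a)
      + outerE (lab ∘ left {n}) (lab ∘ right) a
  f-E-F n lab a = begin
    f-E (ℤ/ m) _≟_ (F n) lab a
      ≡⟨ length-filter≡∑ᴸ (λ (u , v) → (lab u ⊞ lab v) ≟ a) (Graph.edges (F n)) ⟩
    ∑ᴸ (λ (u , v) → δ (lab u ⊞ lab v) a) (Graph.edges (F n))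
      ≡⟨ ∑-edges n (λ (u , v) → δ (lab u ⊞ lab v) a) ⟩
    ∑[ k < n ] (δ (c ⊞ x k) a + δ (c ⊞ y k) a + δ (x k ⊞ y k) a)
      ≡⟨ ∑-distrib-+ {n} (λ k → δ (c ⊞ x k) a + δ (c ⊞ y k) a) (λ k → δ (x k ⊞ y k) a) ⟩
    ∑[ k < n ] (δ (c ⊞ x k) a + δ (c ⊞ y k) a) + outerE x y a
      ≡⟨ cong (_+ outerE x y a) (sum-cong-≗ λ k → cong₂ _+_ (δ-⊞ c (x k) a) (δ-⊞ c (y k) a)) ⟩
    outerV x y ((⊟ c) ⊞ a) + outerE x y a ∎
    where
    open ≡-Reasoning
    c : Fin m
    c = lab zero
    x y : Fin n → Fin m
    x = lab ∘ left
    y = lab ∘ right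

  -- A spoke at an outer vertex labelled z has label c + z, so the spokes labelled
  -- a correspond to the outer vertices labelled a − c.
  Cordial′ : ℕ → Set
  Cordial′ n = ∃ λ c → ∃ λ (x : Fin n → Fin m) → ∃ λ (y : Fin n → Fin m) →
    Balanced (λ a → δ c a + outerV x y a) ×
    Balanced (λ a → outerV x y ((⊟ c) ⊞ a) + outerE x y a)

  cordial⇒cordial′ : ∀ n → Cordial (ℤ/ m) _≟_ (F n) → Cordial′ n
  cordial⇒cordial′ n (lab , bal) =
    lab zero , lab ∘ left , lab ∘ right ,
    balanced-cong (f-V-F n lab) (λ a b → proj₁ (bal a b)) ,
    balanced-cong (f-E-F n lab) (λ a b → proj₂ (bal a b))

  cordial′⇒cordial : ∀ n → Cordial′ n → Cordial (ℤ/ m) _≟_ (F n)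
  cordial′⇒cordial n (c , x , y , balV , balE) = lab , λ a b →
    balanced-cong (λ a → sym (trans (f-V-F n lab a) (cong (δ c a +_) (V≡ a)))) balV a b ,
    balanced-cong (λ a → sym (trans (f-E-F n lab a) (cong₂ _+_ (V≡ ((⊟ c) ⊞ a)) (E≡ a)))) balE a b
    where
    xy : Fin n → Fin 2 → Fin m
    xy k zero    = x k
    xy k (suc _) = y k
    lab : Fin (suc (n * 2)) → Fin m
    lab zero    = c
    lab (suc i) = uncurry xy (remQuot {n} 2 i)
    -- `remQuot` undoes `combine` only up to a propositional equality, which the counts below must
    -- carry along.
    lab-combine : ∀ k j → lab (suc (combine k j)) ≡ xy k j
    lab-combine k j = cong (uncurry xy) (Fin.remQuot-combine k j)
    V≡ : outerV (lab ∘ left {n}) (lab ∘ right) ≗ outerV x y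
    V≡ a = sum-cong-≗ {n} λ k → cong₂ (λ u v → δ u a + δ v a) (lab-combine k _) (lab-combine k _)
    E≡ : outerE (lab ∘ left {n}) (lab ∘ right) ≗ outerE x y
    E≡ a = sum-cong-≗ {n} λ k → cong₂ (λ u v → δ (u ⊞ v) a) (lab-combine k _) (lab-combine k _)

  cordial-F₀ : Cordial (ℤ/ m) _≟_ (F 0)
  cordial-F₀ = cordial′⇒cordial 0
    ( 0 mod m , (λ ()) , (λ ())
    , balanced-≤1 (λ a → δ (0 mod m) a + 0)
        (λ a → subst (_≤ 1) (sym (ℕ.+-identityʳ (δ (0 mod m) a))) (δ≤1 (0 mod m) a))
    -- Without edges all edge counts are 0.
    , λ _ _ → z≤n )

  -- Adding uniform families of triangles

  Uniform : ℕ → Set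
  Uniform N = ∃ λ (x : Fin N → Fin m) → ∃ λ (y : Fin N → Fin m) → ∃ λ v → ∃ λ e →
    (∀ a → outerV x y a ≡ v) × (∀ a → outerE x y a ≡ e)

  module _ {M N} (x y : Fin M → Fin m) (x′ y′ : Fin N → Fin m) where

    ∑-++ : (h : Fin m → Fin m → ℕ) →
      ∑[ k < M + N ] h ((x ++ x′) k) ((y ++ y′) k) ≡
      ∑[ k < M ] h (x k) (y k) + ∑[ k < N ] h (x′ k) (y′ k)
    ∑-++ h = trans (∑-split M _) (cong₂ _+_
      (sum-cong-≗ λ k → cong₂ h (lookup-++ˡ x x′ k) (lookup-++ˡ y y′ k))
      (sum-cong-≗ λ k → cong₂ h (lookup-++ʳ x x′ k) (lookup-++ʳ y y′ k)))

    outerV-++ : ∀ a → outerV (x ++ x′) (y ++ y′) a ≡ outerV x y a + outerV x′ y′ a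
    outerV-++ a = ∑-++ (λ u v → δ u a + δ v a)

    outerE-++ : ∀ a → outerE (x ++ x′) (y ++ y′) a ≡ outerE x y a + outerE x′ y′ a
    outerE-++ a = ∑-++ (λ u v → δ (u ⊞ v) a)

  -- Spokes are counted by `outerV` at an argument shifted by the label of the centre. As the new
  -- triangles raise `outerV` by `v` at every argument, the shift is harmless: vertex counts grow by
  -- `v` and edge counts by `v + e`.
  cordial-+ : ∀ n {N} → Uniform N → Cordial (ℤ/ m) _≟_ (F n) → Cordial (ℤ/ m) _≟_ (F (n + N))
  cordial-+ n {N} (x′ , y′ , v , e , V≡v , E≡e) cordial
    with c , x , y , balV , balE ← cordial⇒cordial′ n cordial =
    cordial′⇒cordial (n + N)
      ( c , x ++ x′ , y ++ y′
      , balanced-+const (λ a → δ c a + outerV x y a)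
        (λ a → trans (cong (δ c a +_) (V≡ a)) (sym (ℕ.+-assoc (δ c a) (outerV x y a) v))) balV
      , balanced-+const (λ a → outerV x y ((⊟ c) ⊞ a) + outerE x y a)
        (λ a → trans
          (cong₂ _+_ (V≡ ((⊟ c) ⊞ a)) (trans (outerE-++ x y x′ y′ a) (cong (outerE x y a +_) (E≡e a))))
          (rearrange (outerV x y ((⊟ c) ⊞ a)) v (outerE x y a) e)) balE )
    where
    V≡ : ∀ a → outerV (x ++ x′) (y ++ y′) a ≡ outerV x y a + v
    V≡ a = trans (outerV-++ x y x′ y′ a) (cong (outerV x y a +_) (V≡v a))
    rearrange : ∀ p q r s → p + q + (r + s) ≡ p + r + (q + s)
    rearrange = solve-∀

  cordial-+* : ∀ n {N} → Uniform N → ∀ k → Cordial (ℤ/ m) _≟_ (F n) →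
               Cordial (ℤ/ m) _≟_ (F (n + k * N))
  cordial-+* n     uniform zero    cordial =
    subst (Cordial (ℤ/ m) _≟_ ∘ F) (sym (ℕ.+-identityʳ n)) cordial
  cordial-+* n {N} uniform (suc k) cordial =
    subst (Cordial (ℤ/ m) _≟_ ∘ F) (ℕ.+-assoc n N (k * N))
      (cordial-+* (n + N) uniform k (cordial-+ n uniform cordial))

  uniform⇒periodic : ∀ {N} .{{_ : NonZero N}} → Uniform N →
    Cordial (ℤ/ m) _≟_ (F N) ×
    ((∀ n → Cordial (ℤ/ m) _≟_ (F n)) ⇔
     (∀ n → 1 ≤ n → n < N → Cordial (ℤ/ m) _≟_ (F n)))
  uniform⇒periodic {N} uniform =
    cordial-+ 0 uniform cordial-F₀ ,
    mk⇔ (λ all n _ _ → all n) λ below n →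
      subst (Cordial (ℤ/ m) _≟_ ∘ F) (sym (ℕ.m≡m%n+[m/n]*n n N))
        (cordial-+* (n % N) uniform (n ℕ./ N) (remainder below (n % N) (ℕ.m%n<n n N)))
    where
    remainder : (∀ n → 1 ≤ n → n < N → Cordial (ℤ/ m) _≟_ (F n)) →
                ∀ r → r < N → Cordial (ℤ/ m) _≟_ (F r)
    -- The assumption starts at 1, so remainder 0 rests on the one-vertex graph.
    remainder below zero    _   = cordial-F₀
    remainder below (suc r) r<N = below (suc r) (s≤s z≤n) r<N

  -- Residues modulo m

  mod-cong : ∀ k l → k % m ≡ l % m → k mod m ≡ l mod m
  mod-cong k l eq = Fin.toℕ-injective
    (trans (toℕ-mod m k) (trans eq (sym (toℕ-mod m l))))

  mod-toℕ : ∀ i → toℕ i mod m ≡ i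
  mod-toℕ i = Fin.toℕ-injective (trans (toℕ-mod m (toℕ i)) (toℕ-% m i))

  mod-homo-⊞ : ∀ k l → (k mod m) ⊞ (l mod m) ≡ (k + l) mod m
  mod-homo-⊞ k l = mod-cong (toℕ (k mod m) + toℕ (l mod m)) (k + l) (trans
    (cong₂ (λ x y → (x + y) % m) (toℕ-mod m k) (toℕ-mod m l))
    (sym (ℕ.%-distribˡ-+ k l m)))

  %-*ˡ : ∀ k l → (k % m * l) % m ≡ (k * l) % m
  %-*ˡ k l = begin
    (k % m * l) % m            ≡⟨ ℕ.%-distribˡ-* (k % m) l m ⟩
    (k % m % m * (l % m)) % m  ≡⟨ cong (λ x → (x * (l % m)) % m) (ℕ.m%n%n≡m%n k m) ⟩
    (k % m * (l % m)) % m      ≡⟨ ℕ.%-distribˡ-* k l m ⟨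
    (k * l) % m                ∎
    where open ≡-Reasoning

  ∑-δ-id : ∀ a → ∑[ k < m ] δ k a ≡ 1
  ∑-δ-id = ∑-δ-bijective id id (λ _ → refl) (λ _ → refl)

  ∑-δ-translate : ∀ c a → ∑[ k < m ] δ (c ⊞ k) a ≡ 1
  ∑-δ-translate c = ∑-δ-bijective (c ⊞_) ((⊟ c) ⊞_) (\\-leftDividesˡ c) (\\-leftDividesʳ c)

  -- Uniform families for odd and for arbitrary moduli

  uniform-odd : ∀ h → m ≡ 1 + h * 2 → Uniform m
  uniform-odd h m≡1+2h = id , id , 2 , 1 ,
    (λ a → trans (∑-distrib-+ {m} (λ k → δ k a) (λ k → δ k a)) (cong₂ _+_ (∑-δ-id a) (∑-δ-id a))) ,
    ∑-δ-bijective (λ k → k ⊞ k) half double-half half-double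
    where
    open ≡-Reasoning
    -- From 2(h + 1) = 1 + m, `suc h` is the inverse of 2 modulo `m`; multiplying by it inverts
    -- doubling.
    half : Fin m → Fin m
    half a = (toℕ a * suc h) mod m

    2*suc-h : ∀ k → k * suc h + k * suc h ≡ k + k * m
    2*suc-h k = trans (expand k h) (cong (λ x → k + k * x) (sym m≡1+2h))
      where
      expand : ∀ k h → k * suc h + k * suc h ≡ k + k * (1 + h * 2)
      expand = solve-∀

    double-half : ∀ a → half a ⊞ half a ≡ a
    double-half a = begin
      half a ⊞ half a                          ≡⟨ mod-homo-⊞ (toℕ a * suc h) (toℕ a * suc h) ⟩
      (toℕ a * suc h + toℕ a * suc h) mod m    ≡⟨ cong (_mod m) (2*suc-h (toℕ a)) ⟩
      (toℕ a + toℕ a * m) mod m                ≡⟨ mod-cong (toℕ a + toℕ a * m) (toℕ a) (ℕ.[m+kn]%n≡m%n (toℕ a) (toℕ a) m) ⟩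
      toℕ a mod m                              ≡⟨ mod-toℕ a ⟩
      a                                        ∎

    half-double : ∀ k → half (k ⊞ k) ≡ k
    half-double k = begin
      (toℕ (k ⊞ k) * suc h) mod m              ≡⟨ cong (λ x → (x * suc h) mod m) (toℕ-mod m (toℕ k + toℕ k)) ⟩
      ((toℕ k + toℕ k) % m * suc h) mod m
        ≡⟨ mod-cong ((toℕ k + toℕ k) % m * suc h) ((toℕ k + toℕ k) * suc h)
                    (%-*ˡ (toℕ k + toℕ k) (suc h)) ⟩
      ((toℕ k + toℕ k) * suc h) mod m          ≡⟨ cong (_mod m) (ℕ.*-distribʳ-+ (suc h) (toℕ k) (toℕ k)) ⟩
      (toℕ k * suc h + toℕ k * suc h) mod m    ≡⟨ cong (_mod m) (2*suc-h (toℕ k)) ⟩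
      (toℕ k + toℕ k * m) mod m                ≡⟨ mod-cong (toℕ k + toℕ k * m) (toℕ k) (ℕ.[m+kn]%n≡m%n (toℕ k) (toℕ k) m) ⟩
      toℕ k mod m                              ≡⟨ mod-toℕ k ⟩
      k                                        ∎

  -- The numbers below m and those from m to 2m - 1 each meet every residue once.
  ∑-residues-below-2m : ∀ a → ∑[ j < m * 2 ] δ (toℕ j mod m) a ≡ 2
  ∑-residues-below-2m a = begin
    ∑[ j < m * 2 ] δ (toℕ j mod m) a
      ≡⟨ cong (λ N → ∑[ j < N ] δ (toℕ j mod m) a) m*2≡m+m ⟩
    ∑[ j < m + m ] δ (toℕ j mod m) a
      ≡⟨ ∑-split m (λ j → δ (toℕ j mod m) a) ⟩
    ∑[ k < m ] δ (toℕ (k ↑ˡ m) mod m) a + ∑[ k < m ] δ (toℕ (m ↑ʳ k) mod m) a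
      ≡⟨ cong₂ _+_
           (sum-cong-≗ λ k → cong (λ z → δ z a) (lower k))
           (sum-cong-≗ λ k → cong (λ z → δ z a) (upper k)) ⟩
    ∑[ k < m ] δ k a + ∑[ k < m ] δ k a
      ≡⟨ cong₂ _+_ (∑-δ-id a) (∑-δ-id a) ⟩
    2 ∎
    where
    open ≡-Reasoning
    m*2≡m+m : m * 2 ≡ m + m
    m*2≡m+m = trans (ℕ.*-comm m 2) (cong (m +_) (ℕ.+-identityʳ m))
    lower : ∀ k → toℕ (k ↑ˡ m) mod m ≡ k
    lower k = trans (cong (_mod m) (Fin.toℕ-↑ˡ k m)) (mod-toℕ k)
    upper : ∀ k → toℕ (m ↑ʳ k) mod m ≡ k
    upper k = begin
      toℕ (m ↑ʳ k) mod m   ≡⟨ cong (_mod m) (trans (Fin.toℕ-↑ʳ m k) (ℕ.+-comm m (toℕ k))) ⟩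
      (toℕ k + m) mod m    ≡⟨ mod-cong (toℕ k + m) (toℕ k) (ℕ.[m+n]%n≡m%n (toℕ k) m) ⟩
      toℕ k mod m          ≡⟨ mod-toℕ k ⟩
      k                    ∎

  uniform-double : Uniform (m + m)
  -- Each of the four outer label families is a permutation of the residues, whence 4.
  uniform-double = id ++ id , id ++ (1ₘ ⊞_) , 4 , 2 , V≡4 , E≡2
    where
    open ≡-Reasoning
    1ₘ : Fin m
    1ₘ = 1 mod m

    V≡4 : ∀ a → outerV {m + m} (id ++ id) (id ++ (1ₘ ⊞_)) a ≡ 4
    V≡4 a = trans (outerV-++ id id id (1ₘ ⊞_) a) (cong₂ _+_
      (trans (∑-distrib-+ {m} (λ k → δ k a) (λ k → δ k a)) (cong₂ _+_ (∑-δ-id a) (∑-δ-id a)))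
      (trans (∑-distrib-+ {m} (λ k → δ k a) (λ k → δ (1ₘ ⊞ k) a)) (cong₂ _+_ (∑-δ-id a) (∑-δ-translate 1ₘ a))))

    even : ∀ k → k ⊞ k ≡ toℕ (combine k (zero {1})) mod m
    even k = cong (_mod m) (trans (double (toℕ k)) (sym (Fin.toℕ-combine k (zero {1}))))
      where
      double : ∀ t → t + t ≡ 2 * t + 0
      double = solve-∀

    odd : ∀ k → k ⊞ (1ₘ ⊞ k) ≡ toℕ (combine k (suc (zero {0}))) mod m
    odd k = begin
      k ⊞ (1ₘ ⊞ k)                   ≡⟨ ℤₘ.assoc k 1ₘ k ⟨
      (k ⊞ 1ₘ) ⊞ k                   ≡⟨ cong (_⊞ k) (ℤₘ.comm k 1ₘ) ⟩
      (1ₘ ⊞ k) ⊞ k                   ≡⟨ ℤₘ.assoc 1ₘ k k ⟩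
      1ₘ ⊞ (k ⊞ k)                   ≡⟨ mod-homo-⊞ 1 (toℕ k + toℕ k) ⟩
      (1 + (toℕ k + toℕ k)) mod m    ≡⟨ cong (_mod m) (double (toℕ k)) ⟩
      (2 * toℕ k + 1) mod m          ≡⟨ cong (_mod m) (Fin.toℕ-combine k (suc (zero {0}))) ⟨
      toℕ (combine k (suc (zero {0}))) mod m ∎
      where
      double : ∀ t → 1 + (t + t) ≡ 2 * t + 1
      double = solve-∀

    E≡2 : ∀ a → outerE {m + m} (id ++ id) (id ++ (1ₘ ⊞_)) a ≡ 2
    E≡2 a = begin
      outerE {m + m} (id ++ id) (id ++ (1ₘ ⊞_)) a
        ≡⟨ outerE-++ id id id (1ₘ ⊞_) a ⟩
      ∑[ k < m ] δ (k ⊞ k) a + ∑[ k < m ] δ (k ⊞ (1ₘ ⊞ k)) a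
        -- Interleaving the two families puts 2k next to 2k + 1, so that `∑-pairs`, read backwards,
        -- yields one sum over all numbers below 2m.
        ≡⟨ ∑-distrib-+ {m} (λ k → δ (k ⊞ k) a) (λ k → δ (k ⊞ (1ₘ ⊞ k)) a) ⟨
      ∑[ k < m ] (δ (k ⊞ k) a + δ (k ⊞ (1ₘ ⊞ k)) a)
        ≡⟨ sum-cong-≗ (λ k → cong₂ (λ u v → δ u a + δ v a) (even k) (odd k)) ⟩
      ∑[ k < m ] (δ (toℕ (combine k (zero {1})) mod m) a + δ (toℕ (combine k (suc (zero {0}))) mod m) a)
        ≡⟨ ∑-pairs m (λ j → δ (toℕ j mod m) a) ⟨
      ∑[ j < m * 2 ] δ (toℕ j mod m) a
        ≡⟨ ∑-residues-below-2m a ⟩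
      2 ∎

  -- Parity of the total edge label

  -- Reduction modulo an even `m` preserves parity, and the unreduced edge sums add up to 2(c + x +
  -- y).
  even-m⇒even-triangle : 2 ∣ m → ∀ c x y → 2 ∣ toℕ (c ⊞ x) + toℕ (c ⊞ y) + toℕ (x ⊞ y)
  even-m⇒even-triangle 2∣m c x y = ℕ.∣m+n∣m⇒∣n
    (subst (2 ∣_) (regroup (s c x) (s c y) (s x y) (t c x) (t c y) (t x y))
      (ℕ.∣m∣n⇒∣m+n (ℕ.∣m∣n⇒∣m+n (parity c x) (parity c y)) (parity x y)))
    (subst (2 ∣_) (double (toℕ c) (toℕ x) (toℕ y)) (ℕ.m∣m*n (toℕ c + toℕ x + toℕ y)))
    where
    s t : Fin m → Fin m → ℕ
    s u v = toℕ u + toℕ v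
    t u v = toℕ (u ⊞ v)

    -- With s = r + q m and t = r, the sum is 2r + q m. Adding s and t expresses equal parity
    -- without subtraction.
    parity : ∀ u v → 2 ∣ s u v + t u v
    parity u v rewrite toℕ-mod m (s u v) = subst (2 ∣_)
      (trans (expand (s u v % m) (s u v ℕ./ m * m))
             (cong (_+ s u v % m) (sym (ℕ.m≡m%n+[m/n]*n (s u v) m))))
      (ℕ.∣m∣n⇒∣m+n (ℕ.m∣m*n (s u v % m)) (ℕ.∣n⇒∣m*n (s u v ℕ./ m) 2∣m))
      where
      expand : ∀ r q → 2 * r + q ≡ r + q + r
      expand = solve-∀

    regroup : ∀ s₁ s₂ s₃ t₁ t₂ t₃ →
      s₁ + t₁ + (s₂ + t₂) + (s₃ + t₃) ≡ s₁ + s₂ + s₃ + (t₁ + t₂ + t₃)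
    regroup = solve-∀

    double : ∀ c x y → 2 * (c + x + y) ≡ c + x + (c + y) + (x + y)
    double = solve-∀

  -- Weight 1 gives the number of edges and weight `toℕ` the sum of the edge labels; both are used
  -- for `cordial-Fₘ⇒4∣m`.
  ∑-edge-labels : ∀ n (lab : Fin (suc (n * 2)) → Fin m) (w : Fin m → ℕ) →
    ∑[ a < m ] (w a * f-E (ℤ/ m) _≟_ (F n) lab a) ≡
    ∑[ k < n ] (w (lab zero ⊞ lab (left k)) + w (lab zero ⊞ lab (right k))
                + w (lab (left k) ⊞ lab (right k)))
  ∑-edge-labels n lab w = trans
    (∑-fibres (λ (u , v) → lab u ⊞ lab v) w (Graph.edges (F n)))
    (∑-edges n (λ (u , v) → w (lab u ⊞ lab v)))

  -- Each label occurs on 3 edges, so the labels sum to 3T with 2T + m = m². Triangle parity makes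
  -- 3T even; hence 4 divides both 6T and 6T + 3m = 3m², and so 3m.
  cordial-Fₘ⇒4∣m : 2 ∣ m → Cordial (ℤ/ m) _≟_ (F m) → 4 ∣ m
  cordial-Fₘ⇒4∣m 2∣m (lab , bal) =
    -- 4 divides 3m + m = 4m, so from 3m it passes to m.
    ℕ.∣m+n∣m⇒∣n (subst (4 ∣_) (ℕ.+-comm m (3 * m)) (ℕ.m∣m*n m)) 4∣3m
    where
    open ≡-Reasoning
    T : ℕ
    T = ∑[ a < m ] toℕ a

    total : ∑[ a < m ] f-E (ℤ/ m) _≟_ (F m) lab a ≡ m * 3
    total = begin
      ∑[ a < m ] f-E (ℤ/ m) _≟_ (F m) lab a
        ≡⟨ sum-cong-≗ (λ a → sym (ℕ.*-identityˡ (f-E (ℤ/ m) _≟_ (F m) lab a))) ⟩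
      ∑[ a < m ] (1 * f-E (ℤ/ m) _≟_ (F m) lab a)
        ≡⟨ ∑-edge-labels m lab (λ _ → 1) ⟩
      ∑[ k < m ] 3
        ≡⟨ ∑-const m 3 ⟩
      m * 3 ∎

    f-E≡3 : ∀ a → f-E (ℤ/ m) _≟_ (F m) lab a ≡ 3
    f-E≡3 = balanced⇒constant (f-E (ℤ/ m) _≟_ (F m) lab) (λ a b → proj₂ (bal a b)) total

    triangle : Fin m → ℕ
    triangle k = toℕ (lab zero ⊞ lab (left k)) + toℕ (lab zero ⊞ lab (right k))
               + toℕ (lab (left k) ⊞ lab (right k))

    3T≡ : 3 * T ≡ sum triangle
    3T≡ = begin
      3 * T
        ≡⟨ *-distribˡ-sum {m} 3 toℕ ⟩
      ∑[ a < m ] (3 * toℕ a)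
        ≡⟨ sum-cong-≗ (λ a → trans (ℕ.*-comm 3 (toℕ a)) (cong (toℕ a *_) (sym (f-E≡3 a)))) ⟩
      ∑[ a < m ] (toℕ a * f-E (ℤ/ m) _≟_ (F m) lab a)
        ≡⟨ ∑-edge-labels m lab toℕ ⟩
      sum triangle ∎

    2∣3T : 2 ∣ 3 * T
    2∣3T = subst (2 ∣_) (sym 3T≡) (∑-∣ 2 triangle λ k →
      even-m⇒even-triangle 2∣m (lab zero) (lab (left k)) (lab (right k)))

    4∣3m : 4 ∣ 3 * m
    4∣3m = ℕ.∣m+n∣m⇒∣n
      (subst (4 ∣_) (sym (trans (collect T m) (cong (3 *_) (∑-toℕ m))))
        (ℕ.∣n⇒∣m*n 3 (ℕ.*-pres-∣ 2∣m 2∣m)))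
      (ℕ.*-pres-∣ (ℕ.∣-refl {2}) 2∣3T)
      where
      collect : ∀ T m → 2 * (3 * T) + 3 * m ≡ 3 * (2 * T + m)
      collect = solve-∀

odd⇒1+h*2 : ∀ m → ¬ 2 ∣ m → ∃ λ h → m ≡ 1 + h * 2
odd⇒1+h*2 m 2∤m with m % 2 in r≡ | ℕ.m%n<n m 2 | ℕ.m≡m%n+[m/n]*n m 2
... | 0             | _               | _  = contradiction (ℕ.m%n≡0⇒n∣m m 2 r≡) 2∤m
... | 1             | _               | m≡ = m ℕ./ 2 , m≡
... | suc (suc _)   | s≤s (s≤s ())    | _

theorem8p3 : (m : ℕ) .{{_ : NonZero m}} →
    (¬ 2 ∣ m →
    Cordial (ℤ/ m) _≟_ (F m) ×
    ((∀ n → Cordial (ℤ/ m) _≟_ (F n)) ⇔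
    (∀ n → 1 ≤ n → n < m → Cordial (ℤ/ m) _≟_ (F n)))) ×
    (2 ∣ m →
    Cordial (ℤ/ m) _≟_ (F (2 * m)) ×
    ((∀ n → Cordial (ℤ/ m) _≟_ (F n)) ⇔
    (∀ n → 1 ≤ n → n < 2 * m → Cordial (ℤ/ m) _≟_ (F n)))) ×
    (2 ∣ m → ¬ 4 ∣ m → ¬ Cordial (ℤ/ m) _≟_ (F m))
theorem8p3 m =
  (λ 2∤m → uniform⇒periodic m (uncurry (uniform-odd m) (odd⇒1+h*2 m 2∤m))) ,
  (λ _ → uniform⇒periodic m {N = 2 * m} {{ℕ.m*n≢0 2 m}}
           -- `2 * m` unfolds to `m + (m + 0)`.
           (subst (Uniform m) (cong (m +_) (sym (ℕ.+-identityʳ m))) (uniform-double m))) ,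
  (λ 2∣m 4∤m cordial → 4∤m (cordial-Fₘ⇒4∣m m 2∣m cordial))
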